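{- For every integer $n\geq 1$, $$A_{O\geq N}(n)-B_{O\geq N}(n)=D(n).$$
   Context: A partition of $n$ is a finite non-increasing sequence of positive integers (its parts) with sum $n$. An overpartition of $n$ is a partition of $n$ in which the first occurrence of each number may be overlined (so for each size $t$ at most one part of size $t$ is overlined); the size of a part $t$ or $\overline{t}$ is $t$, and the weight is the sum of sizes. For an overpartition $\pi$, let $SN(\pi)$ be the size of the smallest non-overlined part of $\pi$ if $\pi$ has non-overlined parts, and $SN(\pi)=0$ otherwise. Let $\ell_{O\geq N}(\pi)$ be the number of overlined parts of $\pi$ of size greater than or equal to $SN(\pi)$. $A_{O\geq N}(n)$ (resp. $B_{O\geq N}(n)$) is the number of overpartitions $\pi$ of $n$ such that $SN(\pi)\geq 1$ and $\ell_{O\geq N}(\pi)$ is even (resp. odd). $D(n)$ is the number of partitions of $n$ into distinct parts. -}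

module Defs where

open import Data.Empty using (⊥)
open import Data.List.Base
  using (List; []; _∷_; _++_; map; filter; length; applyUpTo; cartesianProductWith)
open import Data.List.Extrema.Nat using (min)
open import Data.List.Membership.Propositional using (_∈_; _∉_)
open import Data.List.Membership.Propositional.Properties
  using (∈-filter⁺; ∈-filter⁻; ∈-map⁺; ∈-map⁻; ∈-++⁺ˡ; ∈-++⁺ʳ; ∈-applyUpTo⁺;
         ∈-cartesianProductWith⁺; ∈-cartesianProductWith⁻)
open import Data.List.Properties using (length-map; ∷-injective)
open import Data.List.Relation.Unary.All as All using (All; []; _∷_)
open import Data.List.Relation.Unary.All.Properties using (map⁻)
open import Data.List.Relation.Unary.AllPairs using (AllPairs; []; _∷_; allPairs?)
open import Data.List.Relation.Unary.Any using (here; there)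
open import Data.List.Relation.Unary.Linked using (Linked; linked?)
open import Data.List.Relation.Unary.Unique.Propositional using (Unique)
import Data.List.Relation.Unary.Unique.Propositional.Properties as Unique
open import Data.Nat.Base
  using (ℕ; zero; suc; _≤_; _≥_; z≤n; s≤s; parity)
open import Data.Nat.ListAction using (sum)
open import Data.Nat.Properties
  using (_≟_; _≥?_; +-mono-≤; ≤-refl; ≤-reflexive; ≤-trans; <⇒≢; suc-injective; m≤m+n; m≤n+m)
open import Data.Parity.Base using (0ℙ; 1ℙ)
open import Data.Parity.Properties using () renaming (_≟_ to _≟ℙ_)
open import Data.Product.Base using (_×_; _,_; proj₁; proj₂)
open import Function.Base using (_∘_)
open import Function.Bundles using (_⇔_; mk⇔)
open import Relation.Binary.PropositionalEquality using (_≡_; _≢_; refl; sym; subst)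
open import Relation.Nullary.Decidable using (Dec; yes; no; ¬?; _×-dec_; _→-dec_)
open import Data.List.Relation.Unary.Unique.DecPropositional _≟_ using (unique?)

record IsPartition (n : ℕ) (ts : List ℕ) : Set where
  constructor mkIsPartition
  field
    nonIncreasing : Linked _≥_ ts
    positive      : All (_≥ 1) ts
    sum≡n         : sum ts ≡ n

data Part : Set where
  plain over : ℕ → Part

size : Part → ℕ
size (plain t) = t
size (over t)  = t

data Overlined : Part → Set where
  over : ∀ t → Overlined (over t)

record IsOverpartition (n : ℕ) (π : List Part) : Set where
  constructor mkIsOverpartition
  field
    isPartition    : IsPartition n (map size π)
    -- An overlined part has no earlier part of the same size.
    overlinedFirst : AllPairs (λ p q → Overlined q → size p ≢ size q) π

nonOverlinedSizes : List Part → List ℕ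
nonOverlinedSizes []            = []
nonOverlinedSizes (plain t ∷ π) = t ∷ nonOverlinedSizes π
nonOverlinedSizes (over t ∷ π)  = nonOverlinedSizes π

overlinedSizes : List Part → List ℕ
overlinedSizes []            = []
overlinedSizes (plain t ∷ π) = overlinedSizes π
overlinedSizes (over t ∷ π)  = t ∷ overlinedSizes π

-- `min t ts` is the minimum of the nonempty list t ∷ ts.
minOrZero : List ℕ → ℕ
minOrZero []       = 0
minOrZero (t ∷ ts) = min t ts

SN : List Part → ℕ
SN π = minOrZero (nonOverlinedSizes π)

ℓ-O≥N : List Part → ℕ
ℓ-O≥N π = length (filter (_≥? SN π) (overlinedSizes π))

isPartition? : ∀ n ts → Dec (IsPartition n ts)
isPartition? n ts with linked? _≥?_ ts | All.all? (_≥? 1) ts | sum ts ≟ n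
... | yes d | yes p | yes s = yes (mkIsPartition d p s)
... | no ¬d | _     | _     = no (¬d ∘ IsPartition.nonIncreasing)
... | yes _ | no ¬p | _     = no (¬p ∘ IsPartition.positive)
... | yes _ | yes _ | no ¬s = no (¬s ∘ IsPartition.sum≡n)

overlined? : ∀ p → Dec (Overlined p)
overlined? (plain t) = no λ ()
overlined? (over t)  = yes (over t)

isOverpartition? : ∀ n π → Dec (IsOverpartition n π)
isOverpartition? n π
  with isPartition? n (map size π)
     | allPairs? (λ p q → overlined? q →-dec ¬? (size p ≟ size q)) π
... | yes p | yes f = yes (mkIsOverpartition p f)
... | no ¬p | _     = no (¬p ∘ IsOverpartition.isPartition)
... | yes _ | no ¬f = no (¬f ∘ IsOverpartition.overlinedFirst)

-- All lists of length at most k with entries from xs.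
words : ∀ {A : Set} → ℕ → List A → List (List A)
words zero    xs = [] ∷ []
words (suc k) xs = [] ∷ cartesianProductWith _∷_ xs (words k xs)

sizesUpTo : ℕ → List ℕ
sizesUpTo n = applyUpTo suc n

partsUpTo : ℕ → List Part
partsUpTo n = map plain (sizesUpTo n) ++ map over (sizesUpTo n)

-- Partitions and overpartitions of n have at most n parts, each of size between
-- 1 and n, so filtering these words loses nothing; the lemmas ∈-partitions,
-- partitions-unique, ∈-overpartitions and overpartitions-unique below show that
-- each object is listed exactly once, so that lengths are counts.
partitions : ℕ → List (List ℕ)
partitions n = filter (isPartition? n) (words n (sizesUpTo n))

overpartitions : ℕ → List (List Part)
overpartitions n = filter (isOverpartition? n) (words n (partsUpTo n))

A-O≥N : ℕ → ℕ
A-O≥N n =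
  length (filter (λ π → (SN π ≥? 1) ×-dec (parity (ℓ-O≥N π) ≟ℙ 0ℙ)) (overpartitions n))

B-O≥N : ℕ → ℕ
B-O≥N n =
  length (filter (λ π → (SN π ≥? 1) ×-dec (parity (ℓ-O≥N π) ≟ℙ 1ℙ)) (overpartitions n))

D : ℕ → ℕ
D n = length (filter unique? (partitions n))

∈-words : ∀ {A : Set} {k} {xs : List A} {w} → length w ≤ k → All (_∈ xs) w → w ∈ words k xs
∈-words {k = zero}  z≤n     []       = here refl
∈-words {k = suc k} z≤n     []       = here refl
∈-words {k = suc k} (s≤s l) (p ∷ ps) = there (∈-cartesianProductWith⁺ _∷_ p (∈-words l ps))

words-unique : ∀ {A : Set} k {xs : List A} → Unique xs → Unique (words k xs)
words-unique zero    u = [] ∷ []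
words-unique (suc k) {xs} u =
  All.tabulate (λ w∈ []≡w → []∉ (subst (_∈ _) (sym []≡w) w∈)) ∷
  Unique.cartesianProductWith⁺ _∷_ ∷-injective u (words-unique k u)
  where
  []∉ : [] ∉ cartesianProductWith _∷_ xs (words k xs)
  []∉ p with ∈-cartesianProductWith⁻ _∷_ xs (words k xs) p
  ... | _ , _ , _ , _ , ()

length≤sum : ∀ {ts} → All (_≥ 1) ts → length ts ≤ sum ts
length≤sum []       = z≤n
length≤sum (p ∷ ps) = +-mono-≤ p (length≤sum ps)

∈-sizesUpTo : ∀ {n t} → t ≥ 1 → t ≤ n → t ∈ sizesUpTo n
∈-sizesUpTo {t = suc t} _ t≤n = ∈-applyUpTo⁺ suc t≤n

parts∈ : ∀ {n ts} → All (_≥ 1) ts → sum ts ≤ n → All (_∈ sizesUpTo n) ts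
parts∈ []                   _ = []
parts∈ {ts = t ∷ ts} (p ∷ ps) s =
  ∈-sizesUpTo p (≤-trans (m≤m+n t (sum ts)) s) ∷ parts∈ ps (≤-trans (m≤n+m (sum ts) t) s)

∈-partsUpTo : ∀ {n} p → size p ∈ sizesUpTo n → p ∈ partsUpTo n
∈-partsUpTo     (plain t) i = ∈-++⁺ˡ (∈-map⁺ plain i)
∈-partsUpTo {n} (over t)  i = ∈-++⁺ʳ (map plain (sizesUpTo n)) (∈-map⁺ over i)

sizesUpTo-unique : ∀ n → Unique (sizesUpTo n)
sizesUpTo-unique n = Unique.applyUpTo⁺₁ suc n (λ i<j _ → <⇒≢ i<j ∘ suc-injective)

partsUpTo-unique : ∀ n → Unique (partsUpTo n)
partsUpTo-unique n = Unique.++⁺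
  (Unique.map⁺ (λ { refl → refl }) (sizesUpTo-unique n))
  (Unique.map⁺ (λ { refl → refl }) (sizesUpTo-unique n))
  disjoint
  where
  disjoint : ∀ {p} → p ∈ map plain (sizesUpTo n) × p ∈ map over (sizesUpTo n) → ⊥
  disjoint (i , j) with ∈-map⁻ plain i | ∈-map⁻ over j
  ... | _ , _ , refl | _ , _ , ()

∈-partitions : ∀ n ts → ts ∈ partitions n ⇔ IsPartition n ts
∈-partitions n ts = mk⇔
  (proj₂ ∘ ∈-filter⁻ (isPartition? n) {xs = words n (sizesUpTo n)})
  λ { p@(mkIsPartition _ pos refl) →
      ∈-filter⁺ (isPartition? n) (∈-words (length≤sum pos) (parts∈ pos ≤-refl)) p }

partitions-unique : ∀ n → Unique (partitions n)
partitions-unique n =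
  Unique.filter⁺ (isPartition? n) (words-unique n (sizesUpTo-unique n))

∈-overpartitions : ∀ n π → π ∈ overpartitions n ⇔ IsOverpartition n π
∈-overpartitions n π = mk⇔
  (proj₂ ∘ ∈-filter⁻ (isOverpartition? n) {xs = words n (partsUpTo n)})
  λ { o@(mkIsOverpartition (mkIsPartition _ pos refl) _) →
      ∈-filter⁺ (isOverpartition? n)
        (∈-words (≤-trans (≤-reflexive (sym (length-map size π))) (length≤sum pos))
                 (All.map (∈-partsUpTo _) (map⁻ (parts∈ pos ≤-refl))))
        o }

overpartitions-unique : ∀ n → Unique (overpartitions n)
overpartitions-unique n =
  Unique.filter⁺ (isOverpartition? n) (words-unique n (partsUpTo-unique n))

{-# OPTIONS --safe #-}

-- Toggling the overline on the first (hence largest) part keeps SN and changes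
-- ℓ-O≥N by one, as soon as some later part is not overlined.  What is left are
-- the overpartitions whose only non-overlined part is the first one: the other
-- parts are then distinct and smaller, so ℓ-O≥N = 0, and erasing the overlines
-- gives the partitions into distinct parts.

module Submission where

open import Defs
open import Data.Nat.Base using (ℕ; _≥_)
open import Data.Integer.Base using (+_; _-_)
open import Relation.Binary.PropositionalEquality using (_≡_)

open import Data.Empty using (⊥)
open import Data.Integer.Base using (_⊖_)
open import Data.Integer.Properties using ([+m]-[+n]≡m⊖n; ⊖-≥)
open import Data.List.Base using (List; []; _∷_; _++_; map; filter; length)
open import Data.List.Extrema.Nat using (min; v≤min⁺; min≤⊤; min≤xs)
open import Data.List.Membership.Propositional using (_∈_)
open import Data.List.Membership.Propositional.Properties
  using (∈-filter⁺; ∈-filter⁻; ∈-map⁺; ∈-map⁻; ∈-++⁺ˡ; ∈-++⁺ʳ; ∈-++⁻)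
open import Data.List.Membership.Propositional.Properties.WithK using (unique∧set⇒bag)
open import Data.List.Properties
  using (length-map; length-++; map-∘; map-id; filter-accept; filter-none)
open import Data.List.Relation.Binary.BagAndSetEquality using (∼bag⇒↭)
open import Data.List.Relation.Binary.Permutation.Propositional.Properties using (↭-length)
open import Data.List.Relation.Unary.All as All using (All; []; _∷_)
import Data.List.Relation.Unary.All.Properties as All
open import Data.List.Relation.Unary.AllPairs as AllPairs using (AllPairs; []; _∷_)
import Data.List.Relation.Unary.AllPairs.Properties as AllPairs
open import Data.List.Relation.Unary.Linked using (Linked)
open import Data.List.Relation.Unary.Linked.Properties using (Linked⇒AllPairs)
open import Data.List.Relation.Unary.Unique.Propositional using (Unique)
import Data.List.Relation.Unary.Unique.Propositional.Properties as Unique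
open import Data.Nat.Base using (suc; _+_; _∸_; _≤_; parity)
open import Data.Nat.Properties
  using (_≟_; _≥?_; ≤-trans; ≤-antisym; m≤m+n; m+n∸m≡n; ≤∧≢⇒<; <⇒≱)
open import Data.List.Relation.Unary.Unique.DecPropositional _≟_ using (unique?)
open import Data.Parity.Base using (Parity; 0ℙ; 1ℙ; _⁻¹)
open import Data.Parity.Properties using (suc-homo-⁻¹; ⁻¹-involutive) renaming (_≟_ to _≟ℙ_)
open import Data.Product.Base using (∃-syntax; _×_; _,_)
open import Data.Sum.Base using (_⊎_; inj₁; inj₂)
open import Function.Base using (_∘_; flip)
open import Function.Bundles using (mk⇔; Equivalence)
open import Relation.Binary.PropositionalEquality
  using (_≢_; refl; sym; trans; cong; cong₂; subst; module ≡-Reasoning)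
open import Relation.Nullary.Decidable using (Dec; _×-dec_)
open import Relation.Nullary.Negation using (¬_)

-- Counted objects, with the parity as a parameter.

record IsSigned (s : Parity) (n : ℕ) (π : List Part) : Set where
  constructor mkIsSigned
  field
    isOverpartition : IsOverpartition n π
    SN≥1            : SN π ≥ 1
    parity≡         : parity (ℓ-O≥N π) ≡ s

signed? : ∀ s π → Dec (SN π ≥ 1 × parity (ℓ-O≥N π) ≡ s)
signed? s π = (SN π ≥? 1) ×-dec (parity (ℓ-O≥N π) ≟ℙ s)

-- One family for both counts: at `0ℙ` and `1ℙ` its lengths are `A-O≥N n` and `B-O≥N n` by
-- computation.
signedOverpartitions : Parity → ℕ → List (List Part)
signedOverpartitions s n = filter (signed? s) (overpartitions n)

∈-signedOverpartitions⁺ : ∀ s n {π} → IsSigned s n π → π ∈ signedOverpartitions s n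
∈-signedOverpartitions⁺ s n {π} (mkIsSigned o sn par) =
  ∈-filter⁺ (signed? s) (Equivalence.from (∈-overpartitions n π) o) (sn , par)

∈-signedOverpartitions⁻ : ∀ s n {π} → π ∈ signedOverpartitions s n → IsSigned s n π
∈-signedOverpartitions⁻ s n {π} π∈ with ∈-filter⁻ (signed? s) {xs = overpartitions n} π∈
... | o , sn , par = mkIsSigned (Equivalence.to (∈-overpartitions n π) o) sn par

signedOverpartitions-unique : ∀ s n → Unique (signedOverpartitions s n)
signedOverpartitions-unique s n = Unique.filter⁺ (signed? s) (overpartitions-unique n)

distinctPartitions : ℕ → List (List ℕ)
distinctPartitions n = filter unique? (partitions n)

∈-distinctPartitions⁺ : ∀ n {ts} → IsPartition n ts → Unique ts → ts ∈ distinctPartitions n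
∈-distinctPartitions⁺ n {ts} p = ∈-filter⁺ unique? (Equivalence.from (∈-partitions n ts) p)

∈-distinctPartitions⁻ : ∀ n {ts} → ts ∈ distinctPartitions n → IsPartition n ts × Unique ts
∈-distinctPartitions⁻ n {ts} ts∈ with ∈-filter⁻ unique? {xs = partitions n} ts∈
... | p , u = Equivalence.to (∈-partitions n ts) p , u

-- Sizes of plain and overlined parts.

head≥tail : ∀ {t ts} → Linked _≥_ (t ∷ ts) → All (t ≥_) ts
head≥tail l with Linked⇒AllPairs (flip ≤-trans) l
... | t≥ts ∷ _ = t≥ts

nonOverlinedSizes⁺ : ∀ {P : ℕ → Set} π → All P (map size π) → All P (nonOverlinedSizes π)
nonOverlinedSizes⁺ []            []       = []
nonOverlinedSizes⁺ (plain t ∷ π) (p ∷ ps) = p ∷ nonOverlinedSizes⁺ π ps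
nonOverlinedSizes⁺ (over t ∷ π)  (p ∷ ps) = nonOverlinedSizes⁺ π ps

nonOverlinedSizes-over : ∀ ts → nonOverlinedSizes (map over ts) ≡ []
nonOverlinedSizes-over []       = refl
nonOverlinedSizes-over (t ∷ ts) = nonOverlinedSizes-over ts

overlinedSizes-over : ∀ ts → overlinedSizes (map over ts) ≡ ts
overlinedSizes-over []       = refl
overlinedSizes-over (t ∷ ts) = cong (t ∷_) (overlinedSizes-over ts)

allOverlined : ∀ π → nonOverlinedSizes π ≡ [] → π ≡ map over (map size π)
allOverlined []           _  = refl
allOverlined (over t ∷ π) eq = cong (over t ∷_) (allOverlined π eq)

-- A plain first part enters `SN` as the default argument `s` of `min`. Being at least `t`, it
-- cannot lower the minimum and may be replaced by `t`.
min-∷ : ∀ {s t} ts → t ≤ s → min s (t ∷ ts) ≡ min t ts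
min-∷ {s} {t} ts t≤s with min≤xs s (t ∷ ts)
... | m≤t ∷ m≤ts = ≤-antisym (v≤min⁺ m≤t m≤ts)
                             (v≤min⁺ (≤-trans (min≤⊤ t ts) t≤s) (min≤⊤ t ts ∷ min≤xs t ts))

-- The sign-reversing involution on the first part.

toggle : Part → Part
toggle (plain t) = over t
toggle (over t)  = plain t

toggleHead : List Part → List Part
toggleHead []      = []
toggleHead (p ∷ π) = toggle p ∷ π

toggleHead-involutive : ∀ π → toggleHead (toggleHead π) ≡ π
toggleHead-involutive []            = refl
toggleHead-involutive (plain t ∷ π) = refl
toggleHead-involutive (over t ∷ π)  = refl

toggleHead-injective : ∀ {π ρ} → toggleHead π ≡ toggleHead ρ → π ≡ ρ
toggleHead-injective {π} {ρ} eq =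
  trans (sym (toggleHead-involutive π)) (trans (cong toggleHead eq) (toggleHead-involutive ρ))

-- The sizes do not change, and `overlinedFirst` asks about an overline only on the later part of a
-- pair, which is never the head. The same proofs therefore serve before and after.
toggleHead-isOverpartition : ∀ {n} π → IsOverpartition n π → IsOverpartition n (toggleHead π)
toggleHead-isOverpartition []            o = o
toggleHead-isOverpartition (plain t ∷ π) (mkIsOverpartition p (a ∷ as)) =
  mkIsOverpartition p (a ∷ as)
toggleHead-isOverpartition (over t ∷ π)  (mkIsOverpartition p (a ∷ as)) =
  mkIsOverpartition p (a ∷ as)

-- The domain on which toggling flips the parity. It constrains only the parts after the first, so
-- toggling preserves it.
data HasPlainTail : List Part → Set where
  plainTail : ∀ {p π t ts} → nonOverlinedSizes π ≡ t ∷ ts → HasPlainTail (p ∷ π)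

toggleHead-hasPlainTail : ∀ {π} → HasPlainTail π → HasPlainTail (toggleHead π)
toggleHead-hasPlainTail (plainTail eq) = plainTail eq

-- Here `s` is the size of the first part and `π` the rest. As `t ≤ s`, the smallest non-overlined
-- size is attained in `π`, whether or not the head is overlined; for an overlined head, `SN` agrees
-- with `SN π` by computation.
module _ {s t ts} π (eq : nonOverlinedSizes π ≡ t ∷ ts) (t≤s : t ≤ s) where

  SN-plain∷ : SN (plain s ∷ π) ≡ SN π
  SN-plain∷ rewrite eq = min-∷ ts t≤s

  SN≤ : SN π ≤ s
  SN≤ rewrite eq = ≤-trans (min≤⊤ t ts) t≤s

  ℓ-plain∷ : ℓ-O≥N (plain s ∷ π) ≡ ℓ-O≥N π
  ℓ-plain∷ = cong (λ m → length (filter (_≥? m) (overlinedSizes π))) SN-plain∷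

  ℓ-over∷ : ℓ-O≥N (over s ∷ π) ≡ suc (ℓ-O≥N π)
  ℓ-over∷ = cong length (filter-accept (_≥? SN π) SN≤)

parity-suc : ∀ n → parity (suc n) ≡ parity n ⁻¹
parity-suc n = trans (sym (⁻¹-involutive (parity (suc n)))) (cong _⁻¹ (suc-homo-⁻¹ n))

-- Stated for both parities at once, so that it serves both directions of the bijection.
toggleHead-isSigned : ∀ {s n π} → HasPlainTail π → IsSigned s n π → IsSigned (s ⁻¹) n (toggleHead π)
toggleHead-isSigned {π = p ∷ π} (plainTail eq) (mkIsSigned o sn refl)
  -- The head bounds all later sizes, in particular the first non-overlined one, `t`; this yields
  -- the `t≤s` needed above.
  with subst (All _) eq (nonOverlinedSizes⁺ π
         (head≥tail (IsPartition.nonIncreasing (IsOverpartition.isPartition o))))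
toggleHead-isSigned {π = plain s ∷ π} (plainTail eq) (mkIsSigned o sn refl) | t≤s ∷ _ =
  mkIsSigned (toggleHead-isOverpartition (plain s ∷ π) o)
    (subst (_≥ 1) (SN-plain∷ π eq t≤s) sn)
    (trans (cong parity (trans (ℓ-over∷ π eq t≤s) (cong suc (sym (ℓ-plain∷ π eq t≤s)))))
           (parity-suc (ℓ-O≥N (plain s ∷ π))))
toggleHead-isSigned {π = over s ∷ π} (plainTail eq) (mkIsSigned o sn refl) | t≤s ∷ _ =
  mkIsSigned (toggleHead-isOverpartition (over s ∷ π) o)
    (subst (_≥ 1) (sym (SN-plain∷ π eq t≤s)) sn)
    (trans (cong parity (ℓ-plain∷ π eq t≤s))
           (trans (sym (suc-homo-⁻¹ (ℓ-O≥N π)))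
                  (cong (_⁻¹ ∘ parity) (sym (ℓ-over∷ π eq t≤s)))))

-- The overpartitions left over by the involution.

overlineTail : List ℕ → List Part
overlineTail []       = []
overlineTail (t ∷ ts) = plain t ∷ map over ts

sizes-over : ∀ ts → map size (map over ts) ≡ ts
sizes-over ts = trans (sym (map-∘ ts)) (map-id ts)

sizes-overlineTail : ∀ ts → map size (overlineTail ts) ≡ ts
sizes-overlineTail []       = refl
sizes-overlineTail (t ∷ ts) = cong (t ∷_) (sizes-over ts)

-- Erasing the overlines with `map size` is a left inverse.
overlineTail-injective : ∀ {ts us} → overlineTail ts ≡ overlineTail us → ts ≡ us
overlineTail-injective {ts} {us} eq =
  trans (sym (sizes-overlineTail ts)) (trans (cong (map size) eq) (sizes-overlineTail us))

overlineTail-¬plainTail : ∀ ts → ¬ HasPlainTail (overlineTail ts)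
overlineTail-¬plainTail (t ∷ ts) (plainTail eq) with trans (sym (nonOverlinedSizes-over ts)) eq
... | ()

overlineTail-isOverpartition : ∀ {n ts} → IsPartition n ts → Unique ts →
                               IsOverpartition n (overlineTail ts)
overlineTail-isOverpartition {n} {ts} p u = mkIsOverpartition
  (subst (IsPartition n) (sym (sizes-overlineTail ts)) p)
  -- Pairwise distinct sizes give the first-occurrence condition whichever parts are overlined.
  (AllPairs.map (λ ≢ _ → ≢) (AllPairs.map⁻ (subst Unique (sym (sizes-overlineTail ts)) u)))

overlineTail-isPartition : ∀ {n} ts → IsOverpartition n (overlineTail ts) → IsPartition n ts
overlineTail-isPartition {n} ts o =
  subst (IsPartition n) (sizes-overlineTail ts) (IsOverpartition.isPartition o)

over-unique : ∀ {ts} → AllPairs (λ p q → Overlined q → size p ≢ size q) (map over ts) → Unique ts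
over-unique a = AllPairs.map (λ f → f (over _)) (AllPairs.map⁻ a)

-- In every pair the later part is overlined, so the first-occurrence condition amounts to
-- distinctness of all sizes.
overlineTail-unique : ∀ {n} ts → IsOverpartition n (overlineTail ts) → Unique ts
overlineTail-unique []       o = []
overlineTail-unique (t ∷ ts) (mkIsOverpartition _ (a ∷ as)) =
  All.map (λ f → f (over _)) (All.map⁻ a) ∷ over-unique as

overlineTail-ℓ : ∀ {ts} → Linked _≥_ ts → Unique ts → ℓ-O≥N (overlineTail ts) ≡ 0
overlineTail-ℓ {[]}     _ _       = refl
overlineTail-ℓ {t ∷ ts} l (a ∷ _)
  -- After rewriting, the threshold `SN` is the head `t`; the remaining sizes are at most `t` and
  -- different from it, so none is counted.
  rewrite nonOverlinedSizes-over ts | overlinedSizes-over ts =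
  cong length (filter-none (_≥? t)
    (All.zipWith (λ (t≥u , t≢u) → <⇒≱ (≤∧≢⇒< t≥u (t≢u ∘ sym))) (head≥tail l , a)))

overlineTail-SN : ∀ {n ts} → n ≥ 1 → IsPartition n ts → SN (overlineTail ts) ≥ 1
-- This is where `n ≥ 1` enters: the empty partition has `SN` equal to 0, so it is not counted on
-- the overpartition side.
overlineTail-SN {ts = []}     () (mkIsPartition _ _ refl)
overlineTail-SN {ts = t ∷ ts} _  (mkIsPartition _ (t≥1 ∷ _) _)
  rewrite nonOverlinedSizes-over ts = t≥1

overlineTail-isSigned : ∀ {n ts} → n ≥ 1 → IsPartition n ts → Unique ts →
                        IsSigned 0ℙ n (overlineTail ts)
overlineTail-isSigned n≥1 p u = mkIsSigned
  (overlineTail-isOverpartition p u)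
  (overlineTail-SN n≥1 p)
  (cong parity (overlineTail-ℓ (IsPartition.nonIncreasing p) u))

-- The dichotomy and the count.

plainTail⊎overlineTail : ∀ π → SN π ≥ 1 → HasPlainTail π ⊎ ∃[ ts ] π ≡ overlineTail ts
plainTail⊎overlineTail (p ∷ π) sn with nonOverlinedSizes π in eq
plainTail⊎overlineTail (p ∷ π) sn | _ ∷ _ = inj₁ (plainTail eq)
plainTail⊎overlineTail (plain t ∷ π) sn | [] =
  inj₂ (t ∷ map size π , cong (plain t ∷_) (allOverlined π eq))
-- No part is non-overlined, so `SN` takes its default value 0, against `sn`.
plainTail⊎overlineTail (over t ∷ π) sn | [] with subst (λ ts → minOrZero ts ≥ 1) eq sn
... | ()

-- The leftover overpartitions have `ℓ-O≥N` equal to 0, which is even; hence the involution applies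
-- to every odd one.
odd⇒plainTail : ∀ {n π} → IsSigned 1ℙ n π → HasPlainTail π
odd⇒plainTail {π = π} (mkIsSigned o sn par) with plainTail⊎overlineTail π sn
... | inj₁ h          = h
... | inj₂ (ts , refl) with trans (sym par) (cong parity (overlineTail-ℓ
        (IsPartition.nonIncreasing (overlineTail-isPartition ts o)) (overlineTail-unique ts o)))
... | ()

A≡B+D : ∀ n → n ≥ 1 → A-O≥N n ≡ B-O≥N n + D n
A≡B+D n n≥1 = begin
  length As
    -- Duplicate-free lists with the same members are permutations of each other, so membership in
    -- both directions suffices.
    ≡⟨ ↭-length (∼bag⇒↭ (unique∧set⇒bag As! images! (mk⇔ to from))) ⟩
  length (map toggleHead Bs ++ map overlineTail Ds)
    ≡⟨ length-++ (map toggleHead Bs) ⟩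
  length (map toggleHead Bs) + length (map overlineTail Ds)
    ≡⟨ cong₂ _+_ (length-map toggleHead Bs) (length-map overlineTail Ds) ⟩
  length Bs + length Ds
    ∎
  where
  open ≡-Reasoning
  As = signedOverpartitions 0ℙ n
  Bs = signedOverpartitions 1ℙ n
  Ds = distinctPartitions n

  As! : Unique As
  As! = signedOverpartitions-unique 0ℙ n

  images! : Unique (map toggleHead Bs ++ map overlineTail Ds)
  images! = Unique.++⁺
    (Unique.map⁺ toggleHead-injective (signedOverpartitions-unique 1ℙ n))
    (Unique.map⁺ overlineTail-injective (Unique.filter⁺ unique? (partitions-unique n)))
    (λ (i , j) → disjoint i j)
    where
    -- Toggled odd overpartitions still have a plain part after the first, and no `overlineTail ts`
    -- has one.
    disjoint : ∀ {π} → π ∈ map toggleHead Bs → π ∈ map overlineTail Ds → ⊥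
    disjoint i j with ∈-map⁻ toggleHead i | ∈-map⁻ overlineTail j
    ... | ρ , ρ∈ , refl | ts , _ , eq = overlineTail-¬plainTail ts
      (subst HasPlainTail eq (toggleHead-hasPlainTail (odd⇒plainTail (∈-signedOverpartitions⁻ 1ℙ n ρ∈))))

  to : ∀ {π} → π ∈ As → π ∈ map toggleHead Bs ++ map overlineTail Ds
  to {π} π∈ with ∈-signedOverpartitions⁻ 0ℙ n π∈
  ... | a with plainTail⊎overlineTail π (IsSigned.SN≥1 a)
  -- The preimage of `π` is its own toggle, which is odd.
  ... | inj₁ h = ∈-++⁺ˡ (subst (_∈ _) (toggleHead-involutive π)
                   (∈-map⁺ toggleHead (∈-signedOverpartitions⁺ 1ℙ n (toggleHead-isSigned h a))))
  ... | inj₂ (ts , refl) = ∈-++⁺ʳ (map toggleHead Bs) (∈-map⁺ overlineTail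
                   (∈-distinctPartitions⁺ n (overlineTail-isPartition ts o) (overlineTail-unique ts o)))
    where o = IsSigned.isOverpartition a

  from : ∀ {π} → π ∈ map toggleHead Bs ++ map overlineTail Ds → π ∈ As
  from π∈ with ∈-++⁻ (map toggleHead Bs) π∈
  ... | inj₁ i with ∈-map⁻ toggleHead i
  ... | ρ , ρ∈ , refl = ∈-signedOverpartitions⁺ 0ℙ n (toggleHead-isSigned (odd⇒plainTail b) b)
    where b = ∈-signedOverpartitions⁻ 1ℙ n ρ∈
  from π∈ | inj₂ j with ∈-map⁻ overlineTail j
  ... | ts , ts∈ , refl with ∈-distinctPartitions⁻ n ts∈
  ... | p , u = ∈-signedOverpartitions⁺ 0ℙ n (overlineTail-isSigned n≥1 p u)

theorem2p11 : ∀ (n : ℕ) → n ≥ 1 → + A-O≥N n - + B-O≥N n ≡ + D n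
theorem2p11 n n≥1 = begin
  + A-O≥N n - + B-O≥N n         ≡⟨ cong (λ a → + a - + B-O≥N n) (A≡B+D n n≥1) ⟩
  + (B-O≥N n + D n) - + B-O≥N n ≡⟨ [+m]-[+n]≡m⊖n (B-O≥N n + D n) (B-O≥N n) ⟩
  -- Truncated subtraction is exact here because the subtrahend is a summand.
  (B-O≥N n + D n) ⊖ B-O≥N n     ≡⟨ ⊖-≥ (m≤m+n (B-O≥N n) (D n)) ⟩
  + (B-O≥N n + D n ∸ B-O≥N n)   ≡⟨ cong +_ (m+n∸m≡n (B-O≥N n) (D n)) ⟩
  + D n                         ∎
  where open ≡-Reasoning
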